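{- For all integers $n \geq k$, the score of the Prolonger-may-pass $P_k$-saturation game on $K_n$ satisfies \[\tfrac{1}{4}n(k-2) \leq \mathcal{G}_{ -P}(K_n; P_k) \leq \tfrac{1}{2}n(k-1).\]
   Context: $P_k$ denotes the path on $k$ vertices. For a family $\mathcal{F}$ of graphs, a graph is $\mathcal{F}$-free if it contains no member of $\mathcal{F}$ as a subgraph; a subgraph $G \subseteq H$ is $\mathcal{F}$-saturated in $H$ if it is a maximal $\mathcal{F}$-free subgraph of $H$ (no edge of $H$ not in $G$ can be added while keeping it $\mathcal{F}$-free). The $\mathcal{F}$-saturation game on $H$ ($|V(H)|=n$): two players, Prolonger and Shortener, alternately build a graph process starting from the empty graph on $V(H)$; on each turn the player to move adds one edge of $H$ not yet present such that the graph remains $\mathcal{F}$-free; the game ends when the current graph is $\mathcal{F}$-saturated in $H$. Prolonger wants to maximise and Shortener to minimise the number of edges of the final graph (the score); the score under optimal play is the game saturation number. The variant $\mathcal{G}_{ -P}(H;\mathcal{F})$ is the same game except that on his turn Prolonger may decline to add any edge (leaving the graph unchanged), while Shortener must still add an edge on each of her turns; its score is again the number of edges of the final $\mathcal{F}$-saturated graph under optimal play. The stated bounds hold regardless of which player moves first. Here $\mathcal{G}_{ -P}(K_n;P_k)$ denotes this variant with $H = K_n$ and $\mathcal{F} = \{P_k\}$. -}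

module Defs where

open import Data.Nat using (ℕ; suc)
open import Data.Fin using (Fin; toℕ)
open import Data.List using (List; _∷_; []; length)
open import Data.List.Membership.Propositional using (_∈_)
open import Data.Product using (Σ; _×_; _,_)
open import Data.Sum using (_⊎_)
open import Relation.Nullary using (¬_)
open import Relation.Binary.PropositionalEquality using (_≡_; _≢_)
open import Function.Definitions using (Injective)

data Player : Set where
  prolonger shortener : Player

-- A graph on vertex set Fin n, given by its list of edges (u , v).
-- Legal moves only add pairs u ≢ v that are not yet adjacent (in either
-- orientation), so along any play the list has no repeated edge and its
-- length is the number of edges.
Graph : ℕ → Set
Graph n = List (Fin n × Fin n)

Adj : ∀ {n} → Graph n → Fin n → Fin n → Set
Adj G u v = ((u , v) ∈ G) ⊎ ((v , u) ∈ G)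

ContainsPath : ∀ {n} → ℕ → Graph n → Set
ContainsPath {n} k G =
  Σ (Fin k → Fin n) λ f →
    Injective _≡_ _≡_ f ×
    (∀ (i j : Fin k) → toℕ j ≡ suc (toℕ i) → Adj G (f i) (f j))

PathFree : ∀ {n} → ℕ → Graph n → Set
PathFree k G = ¬ ContainsPath k G

Legal : ∀ {n} → ℕ → Graph n → Fin n → Fin n → Set
Legal k G u v = (u ≢ v) × (¬ Adj G u v) × PathFree k ((u , v) ∷ G)

Saturated : ∀ {n} → ℕ → Graph n → Set
Saturated {n} k G = PathFree k G × (∀ (u v : Fin n) → ¬ Legal k G u v)

-- Game G_{-P}(K_n ; P_k): Prolonger may pass, Shortener must move.
-- ProlongerForces k Goal p G : from position G with player p to move,
-- Prolonger has a strategy guaranteeing the final score satisfies Goal.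
data ProlongerForces {n : ℕ} (k : ℕ) (Goal : ℕ → Set) : Player → Graph n → Set where
  done  : ∀ {p G} → Saturated k G → Goal (length G) → ProlongerForces k Goal p G
  pass  : ∀ {G} → ¬ Saturated k G →
          ProlongerForces k Goal shortener G → ProlongerForces k Goal prolonger G
  pmove : ∀ {G} (u v : Fin n) → Legal k G u v →
          ProlongerForces k Goal shortener ((u , v) ∷ G) → ProlongerForces k Goal prolonger G
  smove : ∀ {G} → ¬ Saturated k G →
          (∀ (u v : Fin n) → Legal k G u v → ProlongerForces k Goal prolonger ((u , v) ∷ G)) →
          ProlongerForces k Goal shortener G

data ShortenerForces {n : ℕ} (k : ℕ) (Goal : ℕ → Set) : Player → Graph n → Set where
  done  : ∀ {p G} → Saturated k G → Goal (length G) → ShortenerForces k Goal p G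
  pturn : ∀ {G} → ¬ Saturated k G →
          ShortenerForces k Goal shortener G →
          (∀ (u v : Fin n) → Legal k G u v → ShortenerForces k Goal shortener ((u , v) ∷ G)) →
          ShortenerForces k Goal prolonger G
  smove : ∀ {G} (u v : Fin n) → Legal k G u v →
          ShortenerForces k Goal prolonger ((u , v) ∷ G) → ShortenerForces k Goal shortener G

empty : (n : ℕ) → Graph n
empty n = []

{-# OPTIONS --safe #-}

-- Upper bound: every P_k-free graph obeys the Erdős–Gallai bound.  Grow a path as long as possible.  Either
-- an end of it has small degree and can be deleted, or the end degrees add up to at least its length, so that
-- it can be closed to a Hamiltonian cycle of its vertex set; then an edge leaving that set would give a longer path,
-- so the set (of at most k − 1 vertices) is a union of components and can be deleted.
--
-- Lower bound: Prolonger keeps every component Hamiltonian (or of at most two vertices).  Whenever Shortener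
-- joins two components he closes the resulting Hamiltonian path to a cycle; otherwise he passes.  Components
-- then have fewer than k vertices, so in a saturated position they are cliques whose sizes aᵢ have pairwise
-- sums at least k, which yields k Σ aᵢ ≤ 2 Σ aᵢ².

module Submission where

open import Defs
open import Data.Fin using (Fin; zero; suc; toℕ; inject₁; inject≤; finToFun; funToFin; _≟_)
open import Data.Fin.Properties using (finToFun-funToFin; toℕ-inject≤; toℕ-inject₁; inject≤-injective; injective⇒≤)
  renaming (any? to anyFin?; all? to allFin?)
open import Data.List using (List; []; _∷_; _++_; length; map; reverse; [_]; concat; allFin; lookup)
open import Data.List.Membership.Propositional using (_∈_; find; lose)
open import Data.List.Membership.Propositional.Properties
  using (∈-++⁺ˡ; ∈-++⁺ʳ; ∈-++⁻; ∈-∃++; ∈-concat⁺′; ∈-concat⁻′; ∈-allFin; ∈-lookup)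
import Data.List.Membership.DecPropositional as DecMembership
open import Data.List.Properties using (map-++; length-++; ++-assoc; unfold-reverse; concat-map-[_]; length-tabulate)
open import Data.List.Relation.Binary.Permutation.Propositional
  using (_↭_; ↭-refl; ↭-sym; ↭-trans; ↭-prep; ↭-swap; ↭-reflexive; ↭⇒↭ₛ)
open import Data.List.Relation.Binary.Permutation.Propositional.Properties
  using (map⁺; ↭-length; ++⁺ˡ; ++⁺ʳ; ++⁺; shift; shifts; ++-comm; ↭-reverse; ∈-resp-↭; All-resp-↭)
import Data.List.Relation.Binary.Permutation.Setoid.Properties as ↭ₛ
open import Data.List.Relation.Unary.All as All using (All; []; _∷_)
import Data.List.Relation.Unary.All.Properties as Allₚ
open import Data.List.Relation.Unary.AllPairs using (AllPairs; []; _∷_)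
open import Data.List.Relation.Unary.Any using (Any; here; there; any?; index)
open import Data.List.Relation.Unary.Any.Properties using (lookup-index)
open import Data.List.Relation.Unary.Unique.Propositional using (Unique)
open import Data.List.Relation.Unary.Unique.Propositional.Properties using (allFin⁺)
open import Data.Nat using (ℕ; zero; suc; pred; _+_; _*_; _∸_; _≤_; _<_; z≤n; s≤s; s≤s⁻¹; _≤?_)
open import Data.Nat.ListAction using (sum)
open import Data.Nat.ListAction.Properties using (sum-++; sum-↭)
open import Data.Nat.Properties hiding (_≟_; suc-injective)
open import Data.Nat.Properties using () renaming (_≟_ to _≟ℕ_; suc-injective to ℕ-suc-injective)
open import Data.Nat.Tactic.RingSolver using (solve-∀)
open import Data.Product using (∃; ∃₂; _×_; _,_; proj₁; proj₂)
open import Data.Product.Properties using (≡-dec)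
open import Data.Sum using (_⊎_; inj₁; inj₂; [_,_]′) renaming (swap to ⊎-swap)
open import Relation.Binary using (Decidable; Symmetric)
open import Relation.Binary.PropositionalEquality
  using (_≡_; _≢_; refl; sym; trans; cong; cong₂; subst; subst₂; setoid; module ≡-Reasoning)
open import Relation.Nullary using (¬_; Dec; yes; no; contradiction; ¬?; _×-dec_; _⊎-dec_; _→-dec_)
open import Relation.Nullary.Decidable using () renaming (map′ to mapDec)

-- Finite sums, double sums and indicators.

∑ : {A : Set} → List A → (A → ℕ) → ℕ
∑ xs f = sum (map f xs)

∑-++ : ∀ {A : Set} (xs ys : List A) (f : A → ℕ) → ∑ (xs ++ ys) f ≡ ∑ xs f + ∑ ys f
∑-++ xs ys f = trans (cong sum (map-++ f xs ys)) (sum-++ (map f xs) (map f ys))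

∑-↭ : ∀ {A : Set} {xs ys : List A} (f : A → ℕ) → xs ↭ ys → ∑ xs f ≡ ∑ ys f
∑-↭ f p = sum-↭ (map⁺ f p)

∑-cong : ∀ {A : Set} (xs : List A) {f g : A → ℕ} → (∀ x → f x ≡ g x) → ∑ xs f ≡ ∑ xs g
∑-cong []       eq = refl
∑-cong (x ∷ xs) eq = cong₂ _+_ (eq x) (∑-cong xs eq)

∑-mono : ∀ {A : Set} (xs : List A) {f g : A → ℕ} → (∀ {x} → x ∈ xs → f x ≤ g x) → ∑ xs f ≤ ∑ xs g
∑-mono []       le = z≤n
∑-mono (x ∷ xs) le = +-mono-≤ (le (here refl)) (∑-mono xs (λ x∈ → le (there x∈)))

∑-+ : ∀ {A : Set} (xs : List A) (f g : A → ℕ) → ∑ xs (λ x → f x + g x) ≡ ∑ xs f + ∑ xs g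
∑-+ []       f g = refl
∑-+ (x ∷ xs) f g = trans (cong (f x + g x +_) (∑-+ xs f g)) (lemma (f x) (g x) (∑ xs f) (∑ xs g))
  where
  lemma : ∀ a b c d → a + b + (c + d) ≡ a + c + (b + d)
  lemma = solve-∀

∑-*ʳ : ∀ {A : Set} (xs : List A) (f : A → ℕ) c → ∑ xs (λ x → f x * c) ≡ ∑ xs f * c
∑-*ʳ []       f c = refl
∑-*ʳ (x ∷ xs) f c = trans (cong (f x * c +_) (∑-*ʳ xs f c)) (sym (*-distribʳ-+ c (f x) (∑ xs f)))

∑-const : ∀ {A : Set} (xs : List A) c → ∑ xs (λ _ → c) ≡ length xs * c
∑-const []       c = refl
∑-const (x ∷ xs) c = cong (c +_) (∑-const xs c)

∑-zero : ∀ {A : Set} (xs : List A) {f : A → ℕ} → (∀ {x} → x ∈ xs → f x ≡ 0) → ∑ xs f ≡ 0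
∑-zero []       z = refl
∑-zero (x ∷ xs) z = cong₂ _+_ (z (here refl)) (∑-zero xs (λ x∈ → z (there x∈)))

∑-swap : ∀ {A B : Set} (xs : List A) (ys : List B) (f : A → B → ℕ) →
         ∑ xs (λ x → ∑ ys (f x)) ≡ ∑ ys (λ y → ∑ xs (λ x → f x y))
∑-swap []       ys f = sym (∑-zero ys (λ _ → refl))
∑-swap (x ∷ xs) ys f = trans (cong (∑ ys (f x) +_) (∑-swap xs ys f))
                             (sym (∑-+ ys (f x) (λ y → ∑ xs (λ x → f x y))))

∑∑ : {A : Set} → (A → A → ℕ) → List A → List A → ℕ
∑∑ f S T = ∑ S (λ u → ∑ T (f u))

∑∑-++ʳ : ∀ {A : Set} (f : A → A → ℕ) S T U → ∑∑ f S (T ++ U) ≡ ∑∑ f S T + ∑∑ f S U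
∑∑-++ʳ f S T U = trans (∑-cong S (λ u → ∑-++ T U (f u))) (∑-+ S (λ u → ∑ T (f u)) (λ u → ∑ U (f u)))

∑∑-++ : ∀ {A : Set} (f : A → A → ℕ) S T →
        ∑∑ f (S ++ T) (S ++ T) ≡ ∑∑ f S S + ∑∑ f S T + (∑∑ f T S + ∑∑ f T T)
∑∑-++ f S T = trans (∑-++ S T _) (cong₂ _+_ (∑∑-++ʳ f S S T) (∑∑-++ʳ f T S T))

∑∑-↭ : ∀ {A : Set} (f : A → A → ℕ) {S T} → S ↭ T → ∑∑ f S S ≡ ∑∑ f T T
∑∑-↭ f {S} {T} p = trans (∑-↭ _ p) (∑-cong T (λ u → ∑-↭ (f u) p))

indicator : ∀ {P : Set} → Dec P → ℕ
indicator (yes _) = 1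
indicator (no  _) = 0

indicator-yes : ∀ {P : Set} (d : Dec P) → P → indicator d ≡ 1
indicator-yes (yes _) p = refl
indicator-yes (no ¬p) p = contradiction p ¬p

indicator-no : ∀ {P : Set} (d : Dec P) → ¬ P → indicator d ≡ 0
indicator-no (yes p) ¬p = contradiction p ¬p
indicator-no (no _)  ¬p = refl

indicator≤1 : ∀ {P : Set} (d : Dec P) → indicator d ≤ 1
indicator≤1 (yes _) = ≤-refl
indicator≤1 (no _)  = z≤n

indicator-cong : ∀ {P Q : Set} (d : Dec P) (e : Dec Q) → (P → Q) → (Q → P) → indicator d ≡ indicator e
indicator-cong (yes p) e to from = sym (indicator-yes e (to p))
indicator-cong (no ¬p) e to from = sym (indicator-no e (λ q → ¬p (from q)))

∈⇒↭ : ∀ {A : Set} {x : A} {xs} → x ∈ xs → ∃ λ ys → xs ↭ x ∷ ys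
∈⇒↭ x∈xs with ∈-∃++ x∈xs
... | ys , zs , refl = ys ++ zs , shift _ ys zs

-- Paths and cycles as vertex lists.

-- The list records the visited vertices in order. Distinctness is not built in; it comes from the
-- list being part of one without repetitions.
data Path {A : Set} (R : A → A → Set) : A → A → List A → Set where
  single : ∀ x → Path R x x [ x ]
  step   : ∀ {x y z L} → R x y → Path R y z L → Path R x z (x ∷ L)

-- A Hamiltonian path of the vertex set of `L` starting at `w`. The permutation `M` makes the order
-- of `L` irrelevant.
SpansFrom : {A : Set} (R : A → A → Set) → List A → A → Set
SpansFrom R L w = ∃₂ λ z M → M ↭ L × Path R w z M

module _ {A : Set} {R : A → A → Set} where

  path-∈ : ∀ {x y L} → Path R x y L → x ∈ L
  path-∈ (single _) = here refl
  path-∈ (step _ _) = here refl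

  path-end-∈ : ∀ {x y L} → Path R x y L → y ∈ L
  path-end-∈ (single _) = here refl
  path-end-∈ (step _ p) = there (path-end-∈ p)

  path-nonempty : ∀ {x y L} → Path R x y L → 0 < length L
  path-nonempty (single _) = s≤s z≤n
  path-nonempty (step _ _) = s≤s z≤n

  path-++ : ∀ {x y z w L M} → Path R x y L → R y z → Path R z w M → Path R x w (L ++ M)
  path-++ (single _) r q = step r q
  path-++ (step s p) r q = step s (path-++ p r q)

  path-map : ∀ {Q : A → A → Set} → (∀ {u v} → R u v → Q u v) → ∀ {x y L} → Path R x y L → Path Q x y L
  path-map f (single x) = single x
  path-map f (step r p) = step (f r) (path-map f p)

  path-reverse : Symmetric R → ∀ {x y L} → Path R x y L → Path R y x (reverse L)
  path-reverse sm (single x) = single x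
  path-reverse sm (step {x} {L = L} r p) =
    subst (Path R _ x) (sym (unfold-reverse x L)) (path-++ (path-reverse sm p) (sm r) (single x))

  -- If `w` is the first vertex there is nothing before it, and `Path` has no empty case, so that
  -- situation is a separate alternative.
  path-split : ∀ {x y L w} → Path R x y L → w ∈ L →
    Path R w y L ⊎ ∃₂ λ p q → ∃ λ a → L ≡ p ++ q × Path R x a p × R a w × Path R w y q
  path-split p@(single _) (here refl) = inj₁ p
  path-split p@(step _ _) (here refl) = inj₁ p
  path-split (step {x} r p) (there w∈) with path-split p w∈
  ... | inj₁ q = inj₂ ([ x ] , _ , x , refl , single x , headEdge p q r , q)
    where
    -- Two paths along the same list have the same first vertex, so an edge into one start is an
    -- edge into the other.
    headEdge : ∀ {u v y y′ L} → Path R u y L → Path R v y′ L → R x u → R x v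
    headEdge (single _) (single _) r = r
    headEdge (step _ _) (step _ _) r = r
    headEdge (single _) (step _ ()) r
    headEdge (step _ ()) (single _) r
  ... | inj₂ (p₁ , q , a , refl , P , s , Q) = inj₂ (x ∷ p₁ , q , a , refl , step r P , s , Q)

  -- Cut the cycle just before `w`: follow it to `y`, take the closing edge to `x`, then traverse
  -- the initial piece.
  cycle-spansFrom : ∀ {x y L} → Path R x y L → R y x → ∀ {w} → w ∈ L → SpansFrom R L w
  cycle-spansFrom p closing w∈ with path-split p w∈
  ... | inj₁ q = _ , _ , ↭-refl , q
  ... | inj₂ (p₁ , q , a , refl , P , s , Q) = a , q ++ p₁ , ++-comm q p₁ , path-++ Q closing P

-- The Erdős-Gallai bound.

module ErdősGallai {A : Set} {R : A → A → Set} (R? : Decidable R)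
  (R-sym : Symmetric R) (R-irrefl : ∀ {x} → ¬ R x x) where

  adj : A → A → ℕ
  adj u v = indicator (R? u v)

  adj-sym : ∀ u v → adj u v ≡ adj v u
  adj-sym u v = indicator-cong (R? u v) (R? v u) R-sym R-sym

  adj-swap : ∀ S T → ∑∑ adj S T ≡ ∑∑ adj T S
  adj-swap S T = trans (∑-swap S T adj) (∑-cong T (λ y → ∑-cong S (λ x → adj-sym x y)))

  degree : List A → A → ℕ
  degree L x = ∑ L (adj x)

  -- The chord pair of the Dirac-Ore argument, with `a` just before `b` on the list. The start `z`
  -- is kept apart from `x` so that an induction can run over the tails of a path.
  Crossing : A → A → A → List A → Set
  Crossing x y z L = ∃₂ λ p q → ∃₂ λ a b →
    L ≡ p ++ q × Path R z a p × Path R b y q × R a y × R b x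

  -- Without a crossing, each step z z′ of the path accounts for at most one of the edges x z′ and y z.
  degrees-or-crossing : ∀ x y {z L} → Path R z y L →
    Crossing x y z L ⊎ suc (degree L x + degree L y) ≤ length L + adj x z + adj y y
  degrees-or-crossing x y (single .y) = inj₂ (≤-reflexive (lemma (adj x y) (adj y y)))
    where
    lemma : ∀ s t → suc (s + 0 + (t + 0)) ≡ 1 + s + t
    lemma = solve-∀
  degrees-or-crossing x y (step {z} {z′} {L = L} r p) with degrees-or-crossing x y p
  ... | inj₁ (p₁ , q , a , b , refl , P , Q , ay , bx) = inj₁ (z ∷ p₁ , q , a , b , refl , step r P , Q , ay , bx)
  ... | inj₂ le with R? x z′ | R? y z
  ...   | yes xz′ | yes yz = inj₁ ([ z ] , L , z , z′ , refl , single z , p , R-sym yz , R-sym xz′)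
  ...   | yes _   | no _   = inj₂ (begin
      suc (adj x z + degree L x + (0 + degree L y)) ≡⟨ lemma (adj x z) (degree L x) (degree L y) ⟩
      adj x z + suc (degree L x + degree L y)       ≤⟨ +-monoʳ-≤ (adj x z) le ⟩
      adj x z + (length L + 1 + adj y y)            ≡⟨ lemma′ (adj x z) (length L) (adj y y) ⟩
      suc (length L) + adj x z + adj y y            ∎)
    where
    open ≤-Reasoning
    lemma : ∀ s t u → suc (s + t + (0 + u)) ≡ s + suc (t + u)
    lemma = solve-∀
    lemma′ : ∀ s t u → s + (t + 1 + u) ≡ suc t + s + u
    lemma′ = solve-∀
  ...   | no _    | yz?    = inj₂ (begin
      suc (adj x z + degree L x + (indicator yz? + degree L y)) ≡⟨ lemma (adj x z) (degree L x) (degree L y) (indicator yz?) ⟩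
      adj x z + indicator yz? + suc (degree L x + degree L y)   ≤⟨ +-mono-≤ (+-monoʳ-≤ (adj x z) (indicator≤1 yz?)) le ⟩
      adj x z + 1 + (length L + 0 + adj y y)                    ≡⟨ lemma′ (adj x z) (length L) (adj y y) ⟩
      suc (length L) + adj x z + adj y y                        ∎)
    where
    open ≤-Reasoning
    lemma : ∀ s t u v → suc (s + t + (v + u)) ≡ s + v + suc (t + u)
    lemma = solve-∀
    lemma′ : ∀ s t u → s + 1 + (t + 0 + u) ≡ suc t + s + u
    lemma′ = solve-∀

  module _ (c : ℕ) where

    -- For S without repetitions, L ++ T ↭ S also forces the vertices of the path to be distinct.
    NoLongPath : List A → Set
    NoLongPath S = ∀ {x y L T} → Path R x y L → L ++ T ↭ S → length L ≤ c

    -- Sums over ordered pairs count each edge twice, so the left side is exactly what deleting `C`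
    -- takes off `∑∑ adj S S`. It costs at most `c` per deleted vertex.
    Removable : List A → Set
    Removable S = ∃₂ λ C T → C ++ T ↭ S × 0 < length C × ∑∑ adj C C + 2 * ∑∑ adj C T ≤ length C * c

    module _ {S : List A} (short : NoLongPath S) where

      -- All neighbours of `x` in `S` lie on the path, so deleting `x` alone removes at most twice
      -- its degree in `L`.
      low-end : ∀ {x y L T} → Path R x y L → L ++ T ↭ S → ¬ Any (λ a → R a x) T →
                2 * degree L x ≤ c → Removable S
      low-end {x} {L = L} {T = T} p split none low with ∈⇒↭ (path-∈ p)
      ... | L′ , L↭ = [ x ] , L′ ++ T , ↭-trans (++⁺ʳ T (↭-sym L↭)) split , s≤s z≤n , (begin
            adj x x + 0 + 0 + 2 * (∑ (L′ ++ T) (adj x) + 0)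
              ≡⟨ cong (λ t → adj x x + 0 + 0 + 2 * (t + 0)) (trans (∑-++ L′ T (adj x)) (cong (degree L′ x +_) none′)) ⟩
            adj x x + 0 + 0 + 2 * (degree L′ x + 0 + 0)
              -- A second `adj x x` is added to make the expression exactly twice a degree.
              ≤⟨ m≤n+m _ (adj x x) ⟩
            adj x x + (adj x x + 0 + 0 + 2 * (degree L′ x + 0 + 0))
              ≡⟨ lemma (adj x x) (degree L′ x) ⟩
            2 * (adj x x + degree L′ x)
              ≡⟨ cong (2 *_) (sym (∑-↭ (adj x) L↭)) ⟩
            2 * degree L x
              ≤⟨ low ⟩
            c
              ≡⟨ sym (+-identityʳ c) ⟩
            c + 0 ∎)
        where
        open ≤-Reasoning
        lemma : ∀ s t → s + (s + 0 + 0 + 2 * (t + 0 + 0)) ≡ 2 * (s + t)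
        lemma = solve-∀
        none′ : ∑ T (adj x) ≡ 0
        none′ = ∑-zero T (λ {a} a∈ → indicator-no (R? x a) (λ xa → none (lose a∈ (R-sym xa))))

      -- Without a crossing the end degrees sum to less than `length L`, hence to less than `c`,
      -- although each exceeds half of `c`.
      high-ends-cross : ∀ {x y L} → Path R x y L → length L ≤ c →
        ¬ (2 * degree L x ≤ c) → ¬ (2 * degree L y ≤ c) → Crossing x y x L
      high-ends-cross {x} {y} {L} p len hx hy with degrees-or-crossing x y p
      ... | inj₁ cr = cr
      ... | inj₂ le rewrite indicator-no (R? x x) R-irrefl | indicator-no (R? y y) R-irrefl =
        contradiction (begin-strict
          c + c                               <⟨ +-mono-<-≤ (≰⇒> hx) (<⇒≤ (≰⇒> hy)) ⟩
          2 * degree L x + 2 * degree L y     ≡⟨ sym (*-distribˡ-+ 2 (degree L x) (degree L y)) ⟩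
          2 * (degree L x + degree L y)       ≤⟨ *-monoʳ-≤ 2 (n≤1+n _) ⟩
          2 * suc (degree L x + degree L y)   ≤⟨ *-monoʳ-≤ 2 le ⟩
          2 * (length L + 0 + 0)              ≡⟨ lemma (length L) ⟩
          length L + length L                 ≤⟨ +-mono-≤ len len ⟩
          c + c ∎) (<-irrefl refl)
        where
        open ≤-Reasoning
        lemma : ∀ t → 2 * (t + 0 + 0) ≡ t + t
        lemma = solve-∀

      -- The cycle runs along `p` from `x` to `a`, jumps to `y`, returns along `q` to `b` and closes
      -- at `x`.
      crossing-spansFrom : ∀ {x y L} → Crossing x y x L → ∀ {w} → w ∈ L → SpansFrom R L w
      crossing-spansFrom (p , q , a , b , refl , P , Q , ay , bx) w∈
        with cycle-spansFrom (path-++ P ay (path-reverse R-sym Q)) bx (∈-resp-↭ (++⁺ˡ p (↭-sym (↭-reverse q))) w∈)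
      ... | z , M , M↭ , path = z , M , ↭-trans M↭ (++⁺ˡ p (↭-reverse q)) , path

      -- No edge leaves `L`, and inside `L` there are at most `length L * length L` ordered pairs.
      closed-removable : ∀ {L T} → 0 < length L → L ++ T ↭ S → length L ≤ c →
        ¬ Any (λ w → Any (λ a → R a w) T) L → Removable S
      closed-removable {L} {T} ne split len none = L , T , split , ne , (begin
          ∑∑ adj L L + 2 * ∑∑ adj L T             ≡⟨ cong (λ t → ∑∑ adj L L + 2 * t) none′ ⟩
          ∑∑ adj L L + 0                          ≡⟨ +-identityʳ _ ⟩
          ∑∑ adj L L                              ≤⟨ ∑-mono L (λ {u} _ → ∑-mono L (λ {v} _ → indicator≤1 (R? u v))) ⟩
          ∑ L (λ _ → ∑ L (λ _ → 1))               ≡⟨ ∑-const L _ ⟩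
          length L * ∑ L (λ _ → 1)                ≡⟨ cong (length L *_) (trans (∑-const L 1) (*-identityʳ _)) ⟩
          length L * length L                     ≤⟨ *-monoʳ-≤ (length L) len ⟩
          length L * c                            ∎)
        where
        open ≤-Reasoning
        none′ : ∑∑ adj L T ≡ 0
        none′ = ∑-zero L (λ {w} w∈ → ∑-zero T (λ {a} a∈ →
          indicator-no (R? w a) (λ wa → none (lose w∈ (lose a∈ (R-sym wa))))))

      -- Recursion on the number `m` of vertices off the path: `extend` moves one of them onto it.
      removable : ∀ m {x y L T} → length T ≡ m → Path R x y L → L ++ T ↭ S → Removable S
      extend : ∀ m {x y L T a} → length T ≡ m → Path R x y L → L ++ T ↭ S → a ∈ T → R a x → Removable S

      extend zero    {T = []}    len p split () r
      extend (suc m) {L = L} {T} {a} len p split a∈ r with ∈⇒↭ a∈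
      ... | T′ , T↭ = removable m (ℕ-suc-injective (trans (sym (↭-length T↭)) len)) (step r p)
        (↭-trans (↭-trans (↭-sym (shift a L T′)) (++⁺ˡ L (↭-sym T↭))) split)

      removable m {x} {y} {L} {T} len p split with any? (λ a → R? a x) T | any? (λ a → R? a y) T
      ... | yes fx | _ = let a , a∈ , ax = find fx in extend m len p split a∈ ax
      ... | no _   | yes fy = let a , a∈ , ay = find fy in
        extend m len (path-reverse R-sym p) (↭-trans (++⁺ʳ T (↭-reverse L)) split) a∈ ay
      ... | no nx  | no ny with 2 * degree L x ≤? c | 2 * degree L y ≤? c
      ...   | yes lx | _ = low-end p split nx lx
      ...   | no _   | yes ly = low-end (path-reverse R-sym p) (↭-trans (++⁺ʳ T (↭-reverse L)) split) ny
                (subst (λ t → 2 * t ≤ c) (sym (∑-↭ (adj y) (↭-reverse L))) ly)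
      -- Both ends are high, so the vertices of `L` carry a cycle and a spanning path can start at
      -- any `w` that has a neighbour in `T`.
      ...   | no hx  | no hy with any? (λ w → any? (λ a → R? a w) T) L
      ...     | no closed = closed-removable (path-nonempty p) split (short p split) closed
      ...     | yes f with find f
      ...       | w , w∈ , g with find g | crossing-spansFrom (high-ends-cross p (short p split) hx hy) w∈
      ...         | a , a∈ , aw | z , M , M↭ , q = extend m len q (↭-trans (++⁺ʳ T M↭) split) a∈ aw

    -- Delete a removable set `C` and recurse on the rest `T`; the bound `m` on the length makes the
    -- recursion structural.
    edge-bound : ∀ m S → length S ≤ m → NoLongPath S → ∑∑ adj S S ≤ length S * c
    edge-bound m       []       le short = z≤n
    edge-bound (suc m) S@(s ∷ S′) (s≤s le) short with removable short _ refl (single s) ↭-refl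
    ... | C , T , split , nonempty , removed = begin
        ∑∑ adj S S                                              ≡⟨ ∑∑-↭ adj (↭-sym split) ⟩
        ∑∑ adj (C ++ T) (C ++ T)                                ≡⟨ ∑∑-++ adj C T ⟩
        ∑∑ adj C C + ∑∑ adj C T + (∑∑ adj T C + ∑∑ adj T T)     ≡⟨ cong (λ t → ∑∑ adj C C + ∑∑ adj C T + (t + ∑∑ adj T T)) (adj-swap T C) ⟩
        ∑∑ adj C C + ∑∑ adj C T + (∑∑ adj C T + ∑∑ adj T T)     ≡⟨ lemma (∑∑ adj C C) (∑∑ adj C T) (∑∑ adj T T) ⟩
        ∑∑ adj C C + 2 * ∑∑ adj C T + ∑∑ adj T T                ≤⟨ +-mono-≤ removed (edge-bound m T T≤m T-short) ⟩
        length C * c + length T * c                             ≡⟨ sym (*-distribʳ-+ c (length C) (length T)) ⟩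
        (length C + length T) * c                               ≡⟨ cong (_* c) len ⟩
        length S * c                                            ∎
      where
      open ≤-Reasoning
      lemma : ∀ s t u → s + t + (t + u) ≡ s + 2 * t + u
      lemma = solve-∀
      len : length C + length T ≡ length S
      len = trans (sym (length-++ C)) (↭-length split)
      T≤m : length T ≤ m
      T≤m = s≤s⁻¹ (≤-trans (+-monoˡ-≤ (length T) nonempty) (≤-trans (≤-reflexive len) (s≤s le)))
      T-short : NoLongPath T
      -- A path within `T` is a path within `S` once `C` is counted among the unvisited vertices.
      T-short {L = L} {U} p p↭ = short p
        (↭-trans (↭-reflexive (sym (++-assoc L U C))) (↭-trans (++⁺ʳ C p↭) (↭-trans (++-comm T C) split)))

-- Repetition-free lists and permutations.

Unique-resp-↭ : ∀ {A : Set} {xs ys : List A} → xs ↭ ys → Unique xs → Unique ys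
Unique-resp-↭ {A} p = ↭ₛ.Unique-resp-↭ (setoid A) (↭⇒↭ₛ p)

unique-++ˡ : ∀ {A : Set} (xs : List A) {ys} → Unique (xs ++ ys) → Unique xs
unique-++ˡ []       u       = []
unique-++ˡ (x ∷ xs) (p ∷ u) = Allₚ.++⁻ˡ xs p ∷ unique-++ˡ xs u

unique-disjoint : ∀ {A : Set} {x} (xs : List A) {ys} → Unique (xs ++ ys) → x ∈ xs → ¬ x ∈ ys
unique-disjoint (x ∷ xs) (p ∷ u) (here refl)  x∈ys = All.lookup (Allₚ.++⁻ʳ xs p) x∈ys refl
unique-disjoint (x ∷ xs) (p ∷ u) (there x∈xs) x∈ys = unique-disjoint xs u x∈xs x∈ys

lookup-injective : ∀ {A : Set} {L : List A} → Unique L → ∀ {i j} → lookup L i ≡ lookup L j → i ≡ j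
lookup-injective (p ∷ u) {zero}  {zero}  eq = refl
lookup-injective {L = x ∷ L} (p ∷ u) {zero}  {suc j} eq = contradiction eq (All.lookup p (∈-lookup j))
lookup-injective {L = x ∷ L} (p ∷ u) {suc i} {zero}  eq = contradiction (sym eq) (All.lookup p (∈-lookup i))
lookup-injective (p ∷ u) {suc i} {suc j} eq = cong suc (lookup-injective u eq)

concat-↭ : ∀ {A : Set} {P Q : List (List A)} → P ↭ Q → concat P ↭ concat Q
concat-↭ _↭_.refl         = ↭-refl
concat-↭ (_↭_.prep L p)   = ++⁺ˡ L (concat-↭ p)
concat-↭ {P = _ ∷ _ ∷ P} (_↭_.swap L M p) = ↭-trans (shifts L M) (++⁺ˡ M (++⁺ˡ L (concat-↭ p)))
concat-↭ (_↭_.trans p q)  = ↭-trans (concat-↭ p) (concat-↭ q)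

allPairs-by-↭ : ∀ {A : Set} {Q : A → A → Set} (P : List A) →
                (∀ {x y R} → P ↭ x ∷ y ∷ R → Q x y) → AllPairs Q P
allPairs-by-↭ []      f = []
allPairs-by-↭ (x ∷ P) f =
  All.tabulate (λ y∈P → f (↭-prep x (proj₂ (∈⇒↭ y∈P)))) ∷
  -- The head `x` is moved behind `y` and `z`, into the arbitrary remainder.
  allPairs-by-↭ P (λ {y} {z} p → f (↭-trans (↭-prep x p)
    (↭-trans (↭-swap x y ↭-refl) (↭-prep y (↭-swap x z ↭-refl)))))

-- Sums over blocks and the inequality for component sizes.

∑∑-* : ∀ {A : Set} (S T : List A) (f g : A → ℕ) → ∑∑ (λ u v → f u * g v) S T ≡ ∑ S f * ∑ T g
∑∑-* S T f g = trans (∑-cong S (λ u → trans (∑-cong T (λ v → *-comm (f u) (g v)))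
                                          (trans (∑-*ʳ T g (f u)) (*-comm (∑ T g) (f u)))))
                       (∑-*ʳ S f (∑ T g))

∑∑-+ : ∀ {A : Set} (S T : List A) (f g : A → A → ℕ) →
       ∑∑ (λ u v → f u v + g u v) S T ≡ ∑∑ f S T + ∑∑ g S T
∑∑-+ S T f g = trans (∑-cong S (λ u → ∑-+ T (f u) (g u))) (∑-+ S _ _)

-- The terms between different blocks are natural numbers, so they may be dropped.
∑∑-concat : ∀ {A : Set} (f : A → A → ℕ) P → ∑ P (λ L → ∑∑ f L L) ≤ ∑∑ f (concat P) (concat P)
∑∑-concat f []      = z≤n
∑∑-concat f (L ∷ P) = begin
  ∑∑ f L L + ∑ P (λ L → ∑∑ f L L)                                                ≤⟨ +-monoʳ-≤ (∑∑ f L L) (∑∑-concat f P) ⟩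
  ∑∑ f L L + ∑∑ f (concat P) (concat P)                                          ≤⟨ +-mono-≤ (m≤m+n (∑∑ f L L) _) (m≤n+m _ (∑∑ f (concat P) L)) ⟩
  ∑∑ f L L + ∑∑ f L (concat P) + (∑∑ f (concat P) L + ∑∑ f (concat P) (concat P)) ≡⟨ sym (∑∑-++ f L (concat P)) ⟩
  ∑∑ f (L ++ concat P) (L ++ concat P)                                           ∎
  where open ≤-Reasoning

∑-length : ∀ {A : Set} (P : List (List A)) → ∑ P length ≡ length (concat P)
∑-length []      = refl
∑-length (L ∷ P) = trans (cong (length L +_) (∑-length P)) (sym (length-++ L))

-- The difference of the two sides is the square of `b ∸ a` when `a ≤ b`; the other case is
-- symmetric.
square-sum : ∀ a b → (a + b) * (a + b) ≤ 2 * (a * a + b * b)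
square-sum a b = [ ordered , (λ b≤a → ≤-trans (≤-reflexive (cong (λ t → t * t) (+-comm a b)))
  (≤-trans (ordered b≤a) (≤-reflexive (cong (2 *_) (+-comm (b * b) (a * a)))))) ]′ (≤-total a b)
  where
  identity : ∀ a d → (a + (a + d)) * (a + (a + d)) + d * d ≡ 2 * (a * a + (a + d) * (a + d))
  identity = solve-∀
  ordered : ∀ {a b} → a ≤ b → (a + b) * (a + b) ≤ 2 * (a * a + b * b)
  ordered {a} {b} a≤b = subst (λ b → (a + b) * (a + b) ≤ 2 * (a * a + b * b)) (m+[n∸m]≡n a≤b)
    (≤-trans (m≤m+n _ ((b ∸ a) * (b ∸ a))) (≤-reflexive (identity a (b ∸ a))))

-- Two numbers with sum at least k cannot both be below k / 2, so one of the first two can be dropped.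
size-inequality₂ : ∀ {A : Set} k x y xs (f : A → ℕ) → AllPairs (λ x y → k ≤ f x + f y) (x ∷ y ∷ xs) →
  k * ∑ (x ∷ y ∷ xs) f ≤ 2 * ∑ (x ∷ y ∷ xs) (λ x → f x * f x)
size-inequality₂ k x y [] f ((k≤ ∷ _) ∷ _) = begin
  k * (f x + (f y + 0))                 ≡⟨ cong (λ t → k * (f x + t)) (+-identityʳ (f y)) ⟩
  k * (f x + f y)                       ≤⟨ *-monoˡ-≤ (f x + f y) k≤ ⟩
  (f x + f y) * (f x + f y)             ≤⟨ square-sum (f x) (f y) ⟩
  2 * (f x * f x + f y * f y)           ≡⟨ cong (λ t → 2 * (f x * f x + t)) (sym (+-identityʳ _)) ⟩
  2 * (f x * f x + (f y * f y + 0))     ∎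
  where open ≤-Reasoning
size-inequality₂ k x y (z ∷ xs) f ((xy ∷ xz ∷ xs≥) ∷ (yz ∷ ys≥) ∷ zs≥) with k ≤? 2 * f x
... | yes large = begin
  k * (f x + ∑ (y ∷ z ∷ xs) f)                    ≡⟨ *-distribˡ-+ k (f x) _ ⟩
  k * f x + k * ∑ (y ∷ z ∷ xs) f                  ≤⟨ +-mono-≤ (*-monoˡ-≤ (f x) large) (size-inequality₂ k y z xs f ((yz ∷ ys≥) ∷ zs≥)) ⟩
  2 * f x * f x + 2 * ∑ (y ∷ z ∷ xs) g            ≡⟨ lemma (f x) (∑ (y ∷ z ∷ xs) g) ⟩
  2 * (f x * f x + ∑ (y ∷ z ∷ xs) g)              ∎
  where
  open ≤-Reasoning
  g = λ x → f x * f x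
  lemma : ∀ s t → 2 * s * s + 2 * t ≡ 2 * (s * s + t)
  lemma = solve-∀
... | no small = begin
  k * (f x + (f y + ∑ (z ∷ xs) f))                ≡⟨ lemma k (f x) (f y) (∑ (z ∷ xs) f) ⟩
  k * f y + k * ∑ (x ∷ z ∷ xs) f                  ≤⟨ +-mono-≤ (*-monoˡ-≤ (f y) large) (size-inequality₂ k x z xs f ((xz ∷ xs≥) ∷ zs≥)) ⟩
  2 * f y * f y + 2 * ∑ (x ∷ z ∷ xs) g            ≡⟨ lemma′ (f x) (f y) (∑ (z ∷ xs) g) ⟩
  2 * (f x * f x + (f y * f y + ∑ (z ∷ xs) g))    ∎
  where
  open ≤-Reasoning
  g = λ x → f x * f x
  lemma : ∀ k s t u → k * (s + (t + u)) ≡ k * t + k * (s + u)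
  lemma = solve-∀
  lemma′ : ∀ s t u → 2 * t * t + 2 * (s * s + u) ≡ 2 * (s * s + (t * t + u))
  lemma′ = solve-∀
  large : k ≤ 2 * f y
  large = +-cancelˡ-≤ k k (2 * f y) (begin
    k + k                ≤⟨ +-mono-≤ xy xy ⟩
    f x + f y + (f x + f y) ≡⟨ double (f x) (f y) ⟩
    2 * f x + 2 * f y    ≤⟨ +-monoˡ-≤ (2 * f y) (<⇒≤ (≰⇒> small)) ⟩
    k + 2 * f y          ∎)
    where
    double : ∀ s t → s + t + (s + t) ≡ 2 * s + 2 * t
    double = solve-∀

-- A single number belongs to no pair; there the lower bound on the total takes the place of the
-- pair condition.
size-inequality : ∀ {A : Set} k xs (f : A → ℕ) → AllPairs (λ x y → k ≤ f x + f y) xs → k ≤ ∑ xs f →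
  k * ∑ xs f ≤ 2 * ∑ xs (λ x → f x * f x)
size-inequality k []           f _     k≤ = ≤-reflexive (*-zeroʳ k)
size-inequality k (x ∷ y ∷ xs) f pairs k≤ = size-inequality₂ k x y xs f pairs
size-inequality k (x ∷ [])     f _     k≤ = begin
  k * (f x + 0)               ≤⟨ *-monoˡ-≤ (f x + 0) k≤ ⟩
  (f x + 0) * (f x + 0)       ≤⟨ m≤m+n _ _ ⟩
  2 * ((f x + 0) * (f x + 0)) ≡⟨ cong (2 *_) (lemma (f x)) ⟩
  2 * (f x * f x + 0)         ∎
  where
  open ≤-Reasoning
  lemma : ∀ t → (t + 0) * (t + 0) ≡ t * t + 0
  lemma = solve-∀

-- Adjacency counts and the handshake lemma.

indicator-× : ∀ {P Q : Set} (p : Dec P) (q : Dec Q) → indicator (p ×-dec q) ≡ indicator p * indicator q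
indicator-× (yes _) (yes _) = refl
indicator-× (yes _) (no _)  = refl
indicator-× (no _)  _       = refl

indicator-⊎ : ∀ {P Q : Set} (p : Dec P) (q : Dec Q) → (P → ¬ Q) →
              indicator (p ⊎-dec q) ≡ indicator p + indicator q
indicator-⊎ (yes p) (yes q) excl = contradiction q (excl p)
indicator-⊎ (yes _) (no _)  excl = refl
indicator-⊎ (no _)  (yes _) excl = refl
indicator-⊎ (no _)  (no _)  excl = refl

module _ {n : ℕ} where

  open DecMembership (≡-dec (_≟_ {n}) (_≟_ {n})) using (_∈?_)

  δ : Fin n → Fin n → ℕ
  δ x u = indicator (x ≟ u)

  ∑-δ≤1 : ∀ x {L} → Unique L → ∑ L (δ x) ≤ 1
  ∑-δ≤1 x [] = z≤n
  ∑-δ≤1 x {y ∷ L} (p ∷ u) with x ≟ y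
  ... | yes refl = ≤-reflexive (cong suc (∑-zero L (λ {z} z∈ → indicator-no (x ≟ z) (All.lookup p z∈))))
  ... | no _     = ∑-δ≤1 x u

  ∑-δ : ∀ x → ∑ (allFin n) (δ x) ≡ 1
  ∑-δ x with ∈⇒↭ (∈-allFin x)
  ... | L , p = ≤-antisym (∑-δ≤1 x (allFin⁺ n)) (begin
    1                  ≡⟨ sym (indicator-yes (x ≟ x) refl) ⟩
    δ x x              ≤⟨ m≤m+n _ _ ⟩
    ∑ (x ∷ L) (δ x)    ≡⟨ sym (∑-↭ (δ x) p) ⟩
    ∑ (allFin n) (δ x) ∎)
    where open ≤-Reasoning

  adj? : (G : Graph n) (u v : Fin n) → Dec (Adj G u v)
  adj? G u v = ((u , v) ∈? G) ⊎-dec ((v , u) ∈? G)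

  Adj-sym : ∀ {G : Graph n} → Symmetric (Adj G)
  Adj-sym = ⊎-swap

  Adj-there : ∀ {G : Graph n} {e u v} → Adj G u v → Adj (e ∷ G) u v
  Adj-there (inj₁ p) = inj₁ (there p)
  Adj-there (inj₂ p) = inj₂ (there p)

  -- The invariant of legal play under which the length of the list is the number of edges.
  data Simple : Graph n → Set where
    []  : Simple []
    _∷_ : ∀ {G u v} → u ≢ v × ¬ Adj G u v → Simple G → Simple ((u , v) ∷ G)

  Adj-irrefl : ∀ {G} → Simple G → ∀ {x} → ¬ Adj G x x
  Adj-irrefl ((u≢v , _) ∷ s) (inj₁ (here refl)) = u≢v refl
  Adj-irrefl ((u≢v , _) ∷ s) (inj₂ (here refl)) = u≢v refl
  Adj-irrefl (_ ∷ s) (inj₁ (there p)) = Adj-irrefl s (inj₁ p)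
  Adj-irrefl (_ ∷ s) (inj₂ (there p)) = Adj-irrefl s (inj₂ p)

  adjacency : Graph n → Fin n → Fin n → ℕ
  adjacency G u v = indicator (adj? G u v)

  -- Being adjacent before, being the new pair and being its reverse exclude one another, so the
  -- indicators add.
  adjacency-∷ : ∀ {G x y} → x ≢ y → ¬ Adj G x y → ∀ u v →
    adjacency ((x , y) ∷ G) u v ≡ adjacency G u v + (δ x u * δ y v + δ y u * δ x v)
  adjacency-∷ {G} {x} {y} x≢y ¬xy u v = begin
    adjacency ((x , y) ∷ G) u v
      ≡⟨ indicator-cong (adj? ((x , y) ∷ G) u v) (adj? G u v ⊎-dec (xu,yv ⊎-dec yu,xv)) to from ⟩
    indicator (adj? G u v ⊎-dec (xu,yv ⊎-dec yu,xv))
      ≡⟨ indicator-⊎ (adj? G u v) (xu,yv ⊎-dec yu,xv) new ⟩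
    adjacency G u v + indicator (xu,yv ⊎-dec yu,xv)
      ≡⟨ cong (adjacency G u v +_) (indicator-⊎ xu,yv yu,xv (λ where (refl , refl) (y≡x , _) → x≢y (sym y≡x))) ⟩
    adjacency G u v + (indicator xu,yv + indicator yu,xv)
      ≡⟨ cong (adjacency G u v +_) (cong₂ _+_ (indicator-× (x ≟ u) (y ≟ v)) (indicator-× (y ≟ u) (x ≟ v))) ⟩
    adjacency G u v + (δ x u * δ y v + δ y u * δ x v) ∎
    where
    open ≡-Reasoning
    xu,yv = (x ≟ u) ×-dec (y ≟ v)
    yu,xv = (y ≟ u) ×-dec (x ≟ v)
    to : Adj ((x , y) ∷ G) u v → Adj G u v ⊎ (x ≡ u × y ≡ v ⊎ y ≡ u × x ≡ v)
    to (inj₁ (here refl)) = inj₂ (inj₁ (refl , refl))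
    to (inj₂ (here refl)) = inj₂ (inj₂ (refl , refl))
    to (inj₁ (there p)) = inj₁ (inj₁ p)
    to (inj₂ (there p)) = inj₁ (inj₂ p)
    from : Adj G u v ⊎ (x ≡ u × y ≡ v ⊎ y ≡ u × x ≡ v) → Adj ((x , y) ∷ G) u v
    from (inj₁ p)                    = Adj-there {G} p
    from (inj₂ (inj₁ (refl , refl))) = inj₁ (here refl)
    from (inj₂ (inj₂ (refl , refl))) = inj₂ (here refl)
    new : Adj G u v → ¬ (x ≡ u × y ≡ v ⊎ y ≡ u × x ≡ v)
    new a (inj₁ (refl , refl)) = ¬xy a
    new a (inj₂ (refl , refl)) = ¬xy (Adj-sym {G} a)

  handshake : ∀ {G} → Simple G → ∑∑ (adjacency G) (allFin n) (allFin n) ≡ 2 * length G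
  handshake [] = ∑-zero (allFin n) (λ _ → ∑-zero (allFin n) (λ _ → refl))
  handshake {(x , y) ∷ G} ((x≢y , ¬xy) ∷ s) = begin
    ∑∑ (adjacency ((x , y) ∷ G)) V V
      ≡⟨ ∑-cong V (λ u → ∑-cong V (adjacency-∷ x≢y ¬xy u)) ⟩
    ∑∑ (λ u v → adjacency G u v + (δ x u * δ y v + δ y u * δ x v)) V V
      ≡⟨ ∑∑-+ V V (adjacency G) _ ⟩
    ∑∑ (adjacency G) V V + ∑∑ (λ u v → δ x u * δ y v + δ y u * δ x v) V V
      ≡⟨ cong₂ _+_ (handshake s) (∑∑-+ V V (λ u v → δ x u * δ y v) _) ⟩
    2 * length G + (∑∑ (λ u v → δ x u * δ y v) V V + ∑∑ (λ u v → δ y u * δ x v) V V)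
      ≡⟨ cong (2 * length G +_) (cong₂ _+_ (one x y) (one y x)) ⟩
    2 * length G + 2
      ≡⟨ lemma (length G) ⟩
    2 * suc (length G) ∎
    where
    open ≡-Reasoning
    V = allFin n
    one : ∀ a b → ∑∑ (λ u v → δ a u * δ b v) V V ≡ 1
    one a b = trans (∑∑-* V V (δ a) (δ b)) (cong₂ _*_ (∑-δ a) (∑-δ b))
    lemma : ∀ t → 2 * t + 2 ≡ 2 * suc t
    lemma = solve-∀

  -- Few edges in path-free graphs.

  path-lookup : ∀ {R : Fin n → Fin n → Set} {x y L} → Path R x y L →
                ∀ i j → toℕ j ≡ suc (toℕ i) → R (lookup L i) (lookup L j)
  path-lookup (step r (single _)) zero    (suc zero) eq = r
  path-lookup (step r (step _ _)) zero    (suc zero) eq = r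
  path-lookup (step r p)          (suc i) (suc j)    eq = path-lookup p i j (cong pred eq)
  path-lookup (single _)          zero    zero       ()

  -- The first `k` vertices of a longer path would form a forbidden path.
  pathFree⇒short : ∀ {k G} → PathFree k G → ∀ {x y L} → Path (Adj G) x y L → Unique L → length L < k
  pathFree⇒short {k} {G} free {L = L} p uniq = ≰⇒> λ k≤ → free
    ( (λ i → lookup L (inject≤ i k≤))
    , (λ eq → inject≤-injective k≤ k≤ _ _ (lookup-injective uniq eq))
    , (λ i j eq → path-lookup p (inject≤ i k≤) (inject≤ j k≤)
        (trans (toℕ-inject≤ j k≤) (trans eq (cong suc (sym (toℕ-inject≤ i k≤)))))))

  pathFree⇒few-edges : ∀ {k G} → Simple G → PathFree k G → 2 * length G ≤ n * (k ∸ 1)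
  pathFree⇒few-edges {k} {G} simple free = begin
    2 * length G                              ≡⟨ sym (handshake simple) ⟩
    ∑∑ (adjacency G) (allFin n) (allFin n)    ≤⟨ edge-bound (k ∸ 1) _ (allFin n) ≤-refl short ⟩
    length (allFin n) * (k ∸ 1)               ≡⟨ cong (_* (k ∸ 1)) (length-tabulate {n = n} (λ i → i)) ⟩
    n * (k ∸ 1)                               ∎
    where
    open ≤-Reasoning
    open ErdősGallai (adj? G) (Adj-sym {G}) (Adj-irrefl simple)
    short : NoLongPath (k ∸ 1) (allFin n)
    short {L = L} p split = ∸-monoˡ-≤ 1 (pathFree⇒short free p (unique-++ˡ L (Unique-resp-↭ (↭-sym split) (allFin⁺ n))))

  -- Decidability of legal moves and termination of play.

  -- Vertex sequences are coded by a finite type through `finToFun`, which makes exhaustive search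
  -- possible. The decoding is only pointwise inverse, so each property is transported pointwise.
  containsPath? : ∀ k (G : Graph n) → Dec (ContainsPath k G)
  containsPath? k G = mapDec
    (λ (c , inj , path) → finToFun c , (λ {i} {j} → inj i j) , path)
    (λ (f , inj , path) → funToFin f
      , (λ i j eq → inj (trans (sym (finToFun-funToFin f i)) (trans eq (finToFun-funToFin f j))))
      , (λ i j eq → subst₂ (Adj G) (sym (finToFun-funToFin f i)) (sym (finToFun-funToFin f j)) (path i j eq)))
    (anyFin? (λ c → let f = finToFun {n} {k} c in
      allFin? (λ i → allFin? (λ j → (f i ≟ f j) →-dec (i ≟ j)))
      ×-dec allFin? (λ i → allFin? (λ j → (toℕ j ≟ℕ suc (toℕ i)) →-dec adj? G (f i) (f j)))))

  legal? : ∀ k (G : Graph n) u v → Dec (Legal k G u v)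
  legal? k G u v = ¬? (u ≟ v) ×-dec (¬? (adj? G u v) ×-dec ¬? (containsPath? k ((u , v) ∷ G)))

  stuck-or-move : ∀ k (G : Graph n) → (∀ u v → ¬ Legal k G u v) ⊎ ∃₂ (Legal k G)
  stuck-or-move k G with anyFin? (λ u → anyFin? (legal? k G u))
  ... | yes move = inj₂ move
  ... | no  none = inj₁ (λ u v l → none (u , v , l))

  unsaturated : ∀ {k G} → ∃₂ (Legal {n} k G) → ¬ Saturated k G
  unsaturated (u , v , l) (_ , stuck) = stuck u v l

  legal⇒simple : ∀ {k G u v} → Legal k G u v → Simple G → Simple ((u , v) ∷ G)
  legal⇒simple (u≢v , ¬uv , _) s = (u≢v , ¬uv) ∷ s

  -- m bounds the number of edges still to be added; strategies are built by recursion on it.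
  record Clock (k : ℕ) (G : Graph n) (m : ℕ) : Set where
    constructor clock
    field bound : n * (k ∸ 1) < length G + m

  clock-start : ∀ {k} → Clock k [] (suc (n * (k ∸ 1)))
  clock-start = clock ≤-refl

  clock-tick : ∀ {k G m e} → Clock k G (suc m) → Clock k (e ∷ G) m
  clock-tick {k} {G} {m} (clock c) = clock (subst (n * (k ∸ 1) <_) (+-suc (length G) m) c)

  -- Prolonger's edges need no tick. The counter falls only at Shortener's moves, because a pass
  -- leaves the graph unchanged.
  clock-∷ : ∀ {k G m e} → Clock k G m → Clock k (e ∷ G) m
  clock-∷ (clock c) = clock (m≤n⇒m≤1+n c)

  -- At zero there would be more than `n * (k ∸ 1)` edges, but even twice their number is at most
  -- that.
  clock-running : ∀ {k G} → Simple G → PathFree k G → ¬ Clock k G 0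
  clock-running {k} {G} s free (clock c) = <-irrefl refl (begin-strict
    n * (k ∸ 1)    <⟨ c ⟩
    length G + 0   ≤⟨ +-monoʳ-≤ (length G) z≤n ⟩
    2 * length G   ≤⟨ pathFree⇒few-edges s free ⟩
    n * (k ∸ 1)    ∎)
    where open ≤-Reasoning

  -- Shortener's strategy.

  module _ (k : ℕ) where

    Low : ℕ → Set
    Low s = 2 * s ≤ n * (k ∸ 1)

    -- The bound holds at every path-free position, so any legal move serves Shortener, and the
    -- clock shows that play ends.
    low-prolonger : ∀ m {G} → Clock k G m → Simple G → PathFree k G → ShortenerForces k Low prolonger G
    low-shortener : ∀ m {G} → Clock k G m → Simple G → PathFree k G → ShortenerForces k Low shortener G

    low-shortener m {G} c s free with stuck-or-move k G
    ... | inj₁ stuck = done (free , stuck) (pathFree⇒few-edges s free)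
    low-shortener zero    c s free | inj₂ _ = contradiction c (clock-running s free)
    low-shortener (suc m) {G} c s free | inj₂ (u , v , l) =
      smove u v l (low-prolonger m (clock-tick c) (legal⇒simple l s) (proj₂ (proj₂ l)))

    low-prolonger m {G} c s free with stuck-or-move k G
    ... | inj₁ stuck = done (free , stuck) (pathFree⇒few-edges s free)
    ... | inj₂ move = pturn (unsaturated move) (low-shortener m c s free)
      (λ u v l → low-shortener m (clock-∷ c) (legal⇒simple l s) (proj₂ (proj₂ l)))

  -- Partitions into small unions of components.

  Closed : Graph n → List (Fin n) → Set
  Closed G L = ∀ {u v} → Adj G u v → u ∈ L → v ∈ L

  record Class (k : ℕ) (G : Graph n) (L : List (Fin n)) : Set where
    constructor class
    field
      closed    : Closed G L
      small     : length L < k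
      inhabited : ∃ (_∈ L)

  record Partition (k : ℕ) (G : Graph n) (P : List (List (Fin n))) : Set where
    constructor partition
    field
      cover   : concat P ↭ allFin n
      classes : All (Class k G) P
  open Partition

  partition-↭ : ∀ {k G P Q} → P ↭ Q → Partition k G P → Partition k G Q
  partition-↭ p (partition cov cls) = partition (↭-trans (concat-↭ (↭-sym p)) cov) (All-resp-↭ p cls)

  unique-cover : ∀ {k G P} → Partition k G P → Unique (concat P)
  unique-cover π = Unique-resp-↭ (↭-sym (cover π)) (allFin⁺ n)

  disjoint-head : ∀ {k G A P} → Partition k G (A ∷ P) → ∀ {L x} → L ∈ P → x ∈ A → ¬ x ∈ L
  disjoint-head {A = A} π L∈ x∈A x∈L = unique-disjoint A (unique-cover π) x∈A (∈-concat⁺′ x∈L L∈)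

  locate : ∀ {v} (P : List (List (Fin n))) → v ∈ concat P → ∃₂ λ A Q → P ↭ A ∷ Q × v ∈ A
  locate P v∈ with ∈-concat⁻′ P v∈
  ... | A , v∈A , A∈P = A , proj₁ (∈⇒↭ A∈P) , proj₂ (∈⇒↭ A∈P) , v∈A

  locate-vertex : ∀ {k G P} → Partition k G P → ∀ v → ∃₂ λ A Q → P ↭ A ∷ Q × v ∈ A
  locate-vertex {P = P} π v = locate P (∈-resp-↭ (↭-sym (cover π)) (∈-allFin v))

  -- A path never leaves the class of its first vertex, and that class has too few vertices for an
  -- injective path.
  partition⇒pathFree : ∀ {k G P} → 1 ≤ k → Partition k G P → PathFree k G
  partition⇒pathFree {suc k} {G} _ π (f , inj , path) with locate-vertex π (f zero)
  ... | A , Q , P↭ , f0∈A with All.head (classes (partition-↭ P↭ π))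
  ... | class closed small _ = <⇒≱ small (injective⇒≤ {f = λ i → index (inside i)}
        (λ {i} {j} eq → inj (trans (lookup-index (inside i))
          (trans (cong (lookup A) eq) (sym (lookup-index (inside j)))))))
    where
    -- The recursion is on the index value `m`, since `inject₁ i` is not a structural subterm of
    -- `suc i`.
    inside′ : ∀ m (i : Fin (suc k)) → toℕ i ≡ m → f i ∈ A
    inside′ zero    zero    eq = f0∈A
    inside′ (suc m) (suc i) eq = closed
      (path (inject₁ i) (suc i) (cong suc (sym (toℕ-inject₁ i))))
      (inside′ m (inject₁ i) (trans (toℕ-inject₁ i) (cong pred eq)))
    inside : ∀ i → f i ∈ A
    inside i = inside′ (toℕ i) i refl

  closed-∷ : ∀ {G u v L} → Closed G L → (u ∈ L → v ∈ L) → (v ∈ L → u ∈ L) → Closed ((u , v) ∷ G) L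
  closed-∷ cl uv vu (inj₁ (here refl)) = uv
  closed-∷ cl uv vu (inj₂ (here refl)) = vu
  closed-∷ cl uv vu (inj₁ (there a)) = cl (inj₁ a)
  closed-∷ cl uv vu (inj₂ (there a)) = cl (inj₂ a)

  -- By disjointness the other classes contain neither end of the new edge, so they stay closed.
  add-inside : ∀ {k G A P u v} → Partition k G (A ∷ P) → u ∈ A → v ∈ A → Partition k ((u , v) ∷ G) (A ∷ P)
  add-inside {k} {G} {A} {P} {u} {v} π@(partition cov (class cl sm inh ∷ cls)) u∈ v∈ =
    partition cov (class (closed-∷ {G} cl (λ _ → v∈) (λ _ → u∈)) sm inh ∷ All.tabulate other)
    where
    other : ∀ {L} → L ∈ P → Class k ((u , v) ∷ G) L
    other L∈ with All.lookup cls L∈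
    ... | class cl sm inh = class (closed-∷ {G} cl
      (λ u∈L → contradiction u∈L (disjoint-head π L∈ u∈))
      (λ v∈L → contradiction v∈L (disjoint-head π L∈ v∈))) sm inh

  merge : ∀ {k G A B P} → length A + length B < k →
          Partition k G (A ∷ B ∷ P) → Partition k G ((A ++ B) ∷ P)
  merge {k} {G} {A} {B} {P} small (partition cov (class clA _ (a , a∈) ∷ class clB _ _ ∷ cls)) =
    partition (↭-trans (↭-reflexive (++-assoc A B (concat P))) cov)
      (class cl (subst (_< k) (sym (length-++ A)) small) (a , ∈-++⁺ˡ a∈) ∷ cls)
    where
    cl : Closed G (A ++ B)
    cl uv u∈ with ∈-++⁻ A u∈
    ... | inj₁ u∈A = ∈-++⁺ˡ (clA uv u∈A)
    ... | inj₂ u∈B = ∈-++⁺ʳ A (clB uv u∈B)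

  -- Counting edges in a saturated position.

  module Final {k : ℕ} {G : Graph n} {P} (1≤k : 1 ≤ k) (π : Partition k G P)
               (stuck : ∀ u v → ¬ Legal k G u v) where

    -- A missing edge inside a class would preserve the partition, hence path-freeness, and so be a
    -- legal move.
    clique : ∀ {A Q} → P ↭ A ∷ Q → ∀ {u v} → u ∈ A → v ∈ A → u ≢ v → Adj G u v
    clique P↭ {u} {v} u∈ v∈ u≢v with adj? G u v
    ... | yes uv = uv
    ... | no ¬uv = contradiction
      (u≢v , ¬uv , partition⇒pathFree 1≤k (add-inside (partition-↭ P↭ π) u∈ v∈)) (stuck u v)

    -- If two classes had fewer than `k` vertices together, merging them would leave a valid
    -- partition and an edge between them would be legal.
    large-pair : ∀ {A B Q} → P ↭ A ∷ B ∷ Q → k ≤ length A + length B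
    large-pair {A} {B} P↭ with partition-↭ P↭ π
    ... | ρ@(partition _ (class clA _ (u , u∈) ∷ class _ _ (v , v∈) ∷ _)) = ≮⇒≥ λ small →
      stuck u v ( (λ { refl → disjoint-head ρ (here refl) u∈ v∈ })
                , (λ uv → disjoint-head ρ (here refl) (clA uv u∈) v∈)
                , partition⇒pathFree 1≤k (add-inside (merge small ρ) (∈-++⁺ˡ u∈) (∈-++⁺ʳ A v∈)))

    unique-class : ∀ {A} → A ∈ P → Unique A
    unique-class {A} A∈ = unique-++ˡ A (unique-cover (partition-↭ (proj₂ (∈⇒↭ A∈)) π))

    -- Every ordered pair in the clique is adjacent or on the diagonal, and the diagonal has at most
    -- `length A` entries.
    class-edges : ∀ {A} → A ∈ P → length A * length A ≤ ∑∑ (adjacency G) A A + length A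
    class-edges {A} A∈ = begin
      length A * length A                         ≡⟨ cong (length A *_) (sym (trans (∑-const A 1) (*-identityʳ _))) ⟩
      length A * ∑ A (λ _ → 1)                    ≡⟨ sym (∑-const A _) ⟩
      ∑∑ (λ _ _ → 1) A A                          ≤⟨ ∑-mono A (λ u∈ → ∑-mono A (λ v∈ → pair u∈ v∈)) ⟩
      ∑∑ (λ u v → adjacency G u v + δ u v) A A    ≡⟨ ∑∑-+ A A (adjacency G) δ ⟩
      ∑∑ (adjacency G) A A + ∑∑ δ A A             ≤⟨ +-monoʳ-≤ (∑∑ (adjacency G) A A) (∑-mono A (λ {u} _ → ∑-δ≤1 u (unique-class A∈))) ⟩
      ∑∑ (adjacency G) A A + ∑ A (λ _ → 1)        ≡⟨ cong (∑∑ (adjacency G) A A +_) (trans (∑-const A 1) (*-identityʳ _)) ⟩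
      ∑∑ (adjacency G) A A + length A             ∎
      where
      open ≤-Reasoning
      pair : ∀ {u v} → u ∈ A → v ∈ A → 1 ≤ adjacency G u v + δ u v
      pair {u} {v} u∈ v∈ with u ≟ v
      ... | yes _  = m≤n+m 1 (adjacency G u v)
      ... | no u≢v = ≤-trans (≤-reflexive (sym (indicator-yes (adj? G u v)
                       (clique (proj₂ (∈⇒↭ A∈)) u∈ v∈ u≢v)))) (m≤m+n _ 0)

    ∑-sizes : ∑ P length ≡ n
    ∑-sizes = trans (∑-length P) (trans (↭-length (cover π)) (length-tabulate {n = n} (λ i → i)))

    -- Adding `2 * n` to both sides turns `k ∸ 2` into `k` and makes room for the diagonal pairs of
    -- all classes.
    many-edges : Simple G → 2 ≤ k → k ≤ n → n * (k ∸ 2) ≤ 4 * length G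
    many-edges simple 2≤k k≤n = +-cancelʳ-≤ (2 * n) _ _ (begin
      n * (k ∸ 2) + 2 * n                                                 ≡⟨ cong (n * (k ∸ 2) +_) (*-comm 2 n) ⟩
      n * (k ∸ 2) + n * 2                                                 ≡⟨ sym (*-distribˡ-+ n (k ∸ 2) 2) ⟩
      n * (k ∸ 2 + 2)                                                     ≡⟨ cong (n *_) (m∸n+n≡m 2≤k) ⟩
      n * k                                                               ≡⟨ *-comm n k ⟩
      k * n                                                               ≡⟨ cong (k *_) (sym ∑-sizes) ⟩
      k * ∑ P length                                                      ≤⟨ size-inequality k P length (allPairs-by-↭ P large-pair) (≤-trans k≤n (≤-reflexive (sym ∑-sizes))) ⟩
      2 * ∑ P (λ A → length A * length A)                                 ≤⟨ *-monoʳ-≤ 2 squares ⟩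
      2 * (2 * length G + n)                                              ≡⟨ lemma (length G) n ⟩
      4 * length G + 2 * n                                                ∎)
      where
      open ≤-Reasoning
      lemma : ∀ s t → 2 * (2 * s + t) ≡ 4 * s + 2 * t
      lemma = solve-∀
      squares : ∑ P (λ A → length A * length A) ≤ 2 * length G + n
      squares = begin
        ∑ P (λ A → length A * length A)                            ≤⟨ ∑-mono P class-edges ⟩
        ∑ P (λ A → ∑∑ (adjacency G) A A + length A)                ≡⟨ ∑-+ P _ length ⟩
        ∑ P (λ A → ∑∑ (adjacency G) A A) + ∑ P length              ≤⟨ +-monoˡ-≤ (∑ P length) (∑∑-concat (adjacency G) P) ⟩
        ∑∑ (adjacency G) (concat P) (concat P) + ∑ P length        ≡⟨ cong₂ _+_ (trans (∑∑-↭ (adjacency G) (cover π)) (handshake simple)) ∑-sizes ⟩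
        2 * length G + n                                           ∎

  -- Prolonger's reply.

  -- One condition covering single vertices, single edges and Hamiltonian classes: a spanning path
  -- starts at whichever vertex Shortener attaches to.
  Traceable : Graph n → List (Fin n) → Set
  Traceable G L = ∀ w → w ∈ L → SpansFrom (Adj G) L w

  traceable-∷ : ∀ {G e L} → Traceable G L → Traceable (e ∷ G) L
  traceable-∷ {G} t w w∈ with t w w∈
  ... | z , M , M↭ , p = z , M , M↭ , path-map (Adj-there {G}) p

  Good : ℕ → Graph n → Set
  Good k G = ∃ λ P → Partition k G P × All (Traceable G) P

  -- Arrive at `u` along a reversed spanning path of `A`, cross the new edge, and leave from `v`
  -- along one of `B`.
  spanning-path : ∀ {G : Graph n} {A B u v} → u ∈ A → v ∈ B → Traceable G A → Traceable G B →
    ∃₂ λ x y → ∃ λ L → x ∈ A × y ∈ B × L ↭ A ++ B × Path (Adj ((u , v) ∷ G)) x y L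
  spanning-path {G} u∈ v∈ tA tB with traceable-∷ {G} tA _ u∈ | traceable-∷ {G} tB _ v∈
  ... | x , M , M↭ , p | y , N , N↭ , q = x , y , reverse M ++ N
      , ∈-resp-↭ M↭ (path-end-∈ p) , ∈-resp-↭ N↭ (path-end-∈ q)
      , ++⁺ (↭-trans (↭-reverse M) M↭) N↭
      , path-++ (path-reverse (Adj-sym {(_ , _) ∷ G}) p) (inj₁ (here refl)) q

  module _ {k : ℕ} (2≤k : 2 ≤ k) where

    1≤k : 1 ≤ k
    1≤k = ≤-trans (s≤s z≤n) 2≤k

    respond : ∀ {G u v} → Good k G → Legal k G u v →
      Good k ((u , v) ∷ G) ⊎ ∃₂ λ x y → Legal k ((u , v) ∷ G) x y × Good k ((x , y) ∷ (u , v) ∷ G)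
    respond {G} {u} {v} (P , π , tr) (_ , _ , free) with locate-vertex π u
    ... | A , Q , P↭ , u∈A with partition-↭ P↭ π | All-resp-↭ P↭ tr
    ... | ρ | trA ∷ trQ with ∈-++⁻ A {concat Q} (∈-resp-↭ (↭-sym (cover ρ)) (∈-allFin v))
    ...   | inj₁ v∈A = inj₁ (A ∷ Q , add-inside ρ u∈A v∈A , All.map (traceable-∷ {G}) (trA ∷ trQ))
    ...   | inj₂ v∈Q with locate Q v∈Q
    ...     | B , Q′ , Q↭ , v∈B with partition-↭ (↭-prep A Q↭) ρ | All-resp-↭ Q↭ trQ | spanning-path {G} {A} {B} u∈A v∈B trA
    ...       | σ | trB ∷ trQ′ | span with span trB
    ...         | x , y , L , x∈A , y∈B , L↭ , p = go (adj? G′ y x)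
      where
      G′ = (u , v) ∷ G
      uniqueL : Unique L
      uniqueL = Unique-resp-↭ (↭-sym L↭) (unique-++ˡ (A ++ B)
        (Unique-resp-↭ (↭-reflexive (sym (++-assoc A B (concat Q′)))) (unique-cover σ)))
      -- Legality of Shortener's edge bounds the merged class: its spanning path lies in a path-free
      -- graph.
      size : length A + length B < k
      size = subst (_< k) (trans (↭-length L↭) (length-++ A)) (pathFree⇒short free p uniqueL)
      τ : Partition k G′ ((A ++ B) ∷ Q′)
      τ = add-inside (merge size σ) (∈-++⁺ˡ u∈A) (∈-++⁺ʳ A v∈B)
      cyclic : ∀ {H} → Path (Adj H) x y L → Adj H y x → Traceable H (A ++ B)
      cyclic q yx w w∈ with cycle-spansFrom q yx (∈-resp-↭ (↭-sym L↭) w∈)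
      ... | z , M , M↭ , r = z , M , ↭-trans M↭ L↭ , r
      go : Dec (Adj G′ y x) → _
      -- This happens when both classes are singletons: Shortener's edge itself joins the ends, and
      -- Prolonger adds nothing.
      go (yes yx) = inj₁ (_ , τ , cyclic {G′} p yx ∷ All.map (traceable-∷ {G}) trQ′)
      go (no ¬yx) = inj₂ (y , x , (y≢x , ¬yx , partition⇒pathFree 1≤k τ′) ,
          _ , τ′ , cyclic {(y , x) ∷ G′} (path-map (Adj-there {G′}) p) (inj₁ (here refl))
                   ∷ All.map (λ t → traceable-∷ {G′} (traceable-∷ {G} t)) trQ′)
        where
        τ′ : Partition k ((y , x) ∷ G′) ((A ++ B) ∷ Q′)
        τ′ = add-inside τ (∈-++⁺ʳ A y∈B) (∈-++⁺ˡ x∈A)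
        y≢x : y ≢ x
        y≢x refl = disjoint-head σ (here refl) x∈A y∈B

    good-empty : Good k (empty n)
    good-empty = map [_] (allFin n)
      , partition (↭-reflexive (concat-map-[_] (allFin n)))
          -- Each vertex is its own class; `2≤k` says that size one is below `k`.
          (Allₚ.map⁺ (All.tabulate (λ {x} _ → class (λ { (inj₁ ()) ; (inj₂ ()) }) 2≤k (x , here refl))))
      , Allₚ.map⁺ (All.tabulate (λ { {x} _ _ (here refl) → x , [ x ] , ↭-refl , single x }))

    pathFree-empty : PathFree k (empty n)
    pathFree-empty = partition⇒pathFree 1≤k (proj₁ (proj₂ good-empty))

    low-start : ∀ first → ShortenerForces k (Low k) first (empty n)
    low-start prolonger = low-prolonger k _ clock-start [] pathFree-empty
    low-start shortener = low-shortener k _ clock-start [] pathFree-empty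

    -- Prolonger's strategy.

    module _ (k≤n : k ≤ n) where

      High : ℕ → Set
      High s = n * (k ∸ 2) ≤ 4 * s

      finish : ∀ {p G} → Simple G → Good k G → (∀ u v → ¬ Legal k G u v) → ProlongerForces k High p G
      finish s (P , π , _) stuck =
        done (partition⇒pathFree 1≤k π , stuck) (Final.many-edges 1≤k π stuck s 2≤k k≤n)

      -- `Good` holds whenever Shortener is to move: after her edge, `high-reply` plays the closing
      -- edge if `respond` supplies one, and otherwise passes or recognises the end of play.
      high-shortener : ∀ m {G} → Clock k G m → Simple G → Good k G → ProlongerForces k High shortener G
      high-pass : ∀ m {G} → Clock k G m → Simple G → Good k G → ProlongerForces k High prolonger G
      high-reply : ∀ m {G} u v → Clock k G (suc m) → Simple G → Good k G → Legal k G u v →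
                   ProlongerForces k High prolonger ((u , v) ∷ G)

      high-shortener m {G} c s good with stuck-or-move k G
      ... | inj₁ stuck = finish s good stuck
      high-shortener zero    c s good@(_ , π , _) | inj₂ _ =
        contradiction c (clock-running s (partition⇒pathFree 1≤k π))
      high-shortener (suc m) c s good | inj₂ move =
        smove (unsaturated move) (λ u v l → high-reply m u v c s good l)

      high-pass m {G} c s good with stuck-or-move k G
      ... | inj₁ stuck = finish s good stuck
      ... | inj₂ move  = pass (unsaturated move) (high-shortener m c s good)

      high-reply m {G} u v c s good l with respond good l
      ... | inj₂ (x , y , l′ , good′) = pmove x y l′
            (high-shortener m (clock-∷ (clock-tick c)) (legal⇒simple l′ (legal⇒simple l s)) good′)
      ... | inj₁ good′ = high-pass m (clock-tick c) (legal⇒simple l s) good′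

      high-start : ∀ first → ProlongerForces k High first (empty n)
      high-start prolonger = high-pass _ clock-start [] good-empty
      high-start shortener = high-shortener _ clock-start [] good-empty

theorem1 : ∀ (n k : ℕ) → 2 ≤ k → k ≤ n → ∀ (first : Player) →
    ProlongerForces k (λ s → n * (k ∸ 2) ≤ 4 * s) first (empty n) ×
    ShortenerForces k (λ s → 2 * s ≤ n * (k ∸ 1)) first (empty n)
theorem1 n k 2≤k k≤n first = high-start 2≤k k≤n first , low-start 2≤k first
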